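{- Let $G$ be the incomparability graph of a poset. Suppose that $G$ is connected and has infinite diameter. Then: (1) For every vertex $x$ of $G$ there is a (one way infinite) induced path of $G$ starting at $x$ whose vertex set has infinite diameter in $G$. (2) If the set of vertices of degree at least $3$ in $G$ has infinite diameter in $G$, then $G$ contains an induced subgraph $H$ which is a comb or a kite, such that the vertex set of $H$ has infinite diameter in $G$ and $H$ has infinitely many vertices of degree at least $3$.
   Context: Graphs are undirected, simple, loopless, possibly infinite. For a poset $P=(V,\le)$, the incomparability graph $\mathrm{Inc}(P)$ has vertex set $V$ and edges the pairs of incomparable elements. $d_G(x,y)$ is the length of a shortest path of $G$ from $x$ to $y$ ($\infty$ if none). The diameter in $G$ of a set $X\subseteq V(G)$ is $\sup\{d_G(x,y):x,y\in X\}$; the diameter of $G$ is that of $V(G)$. A one way infinite induced path starting at $x$ is a sequence $x=x_0,x_1,x_2,\dots$ of distinct vertices such that $\{x_i,x_j\}$ is an edge of $G$ iff $|i-j|=1$. A caterpillar is a connected graph such that deleting all vertices of degree one leaves a path (finite or infinite, possibly reduced to one vertex or empty). A comb is a caterpillar in which every vertex is adjacent to at most one vertex of degree one. A kite is a graph obtained from an infinite path $\mathrm P_\infty=(x_i)_{i\in\mathbb N}$ (with edges $\{x_i,x_{i+1}\}$ only) by adding a set $Y$ (finite or infinite) of new pairwise non-adjacent vertices, according to one of the following three types. Type (1): every vertex of $Y$ is adjacent to exactly two vertices of $\mathrm P_\infty$, and these are consecutive in $\mathrm P_\infty$; moreover two distinct vertices of $Y$ have at most one common neighbour in $\mathrm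 P_\infty$. Type (2): every vertex of $Y$ is adjacent to exactly three vertices of $\mathrm P_\infty$, and these are consecutive in $\mathrm P_\infty$; moreover for all distinct $y,y'\in Y$, if $y$ is adjacent to $x_i,x_{i+1},x_{i+2}$ and $y'$ to $x_{i'},x_{i'+1},x_{i'+2}$, then $i+2\le i'$ or $i'+2\le i$. Type (3): every vertex of $Y$ is adjacent to exactly two vertices of $\mathrm P_\infty$, and these are at distance two in $\mathrm P_\infty$; moreover for all distinct $y,y'\in Y$, if $y$ is adjacent to $x_i,x_{i+2}$ and $y'$ to $x_{i'},x_{i'+2}$, then $i+2\le i'$ or $i'+2\le i$. -}

module Defs where

open import Data.Fin.Base using (Fin; zero; suc; fromℕ; inject₁)
open import Data.Integer.Base as ℤ using (ℤ)
open import Data.Nat.Base using (ℕ; zero; suc; _+_; _≤_; ∣_-_∣)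
open import Data.Product.Base using (Σ-syntax; ∃-syntax; _×_; _,_)
open import Data.Refinement using (Refinement-syntax; value)
open import Data.Sum.Base using (_⊎_)
open import Function.Bundles using (_⇔_)
open import Function.Definitions using (Injective)
open import Level using (Level; _⊔_) renaming (suc to lsuc)
open import Relation.Binary.Construct.Add.Supremum.NonStrict _≤_ using (_≤⁺_)
open import Relation.Binary.Core using (Rel)
open import Relation.Binary.PropositionalEquality.Core using (_≡_; _≢_)
open import Relation.Binary.Structures using (IsPartialOrder)
open import Relation.Nullary.Construct.Add.Supremum using (_⁺; [_]; ⊤⁺)
open import Relation.Nullary.Negation.Core using (¬_)
open import Relation.Unary using (Pred)

record Graph (v e : Level) : Set (lsuc (v ⊔ e)) where
  field
    Vertex : Set v
    Adj    : Rel Vertex e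
    sym    : ∀ {x y} → Adj x y → Adj y x
    irrefl : ∀ {x} → ¬ Adj x x

open Graph public using (Vertex)

Inc : ∀ {c ℓ} {V : Set c} {_≼_ : Rel V ℓ} → IsPartialOrder _≡_ _≼_ → Graph c ℓ
Inc {V = V} {_≼_} po = record
  { Vertex = V
  ; Adj    = λ x y → ¬ (x ≼ y) × ¬ (y ≼ x)
  ; sym    = λ (x⋠y , y⋠x) → y⋠x , x⋠y
  ; irrefl = λ (x⋠x , _) → x⋠x (IsPartialOrder.refl po)
  }

-- Membership in S is proof-irrelevant in the refinement type, so two vertices
-- of the induced subgraph are equal as soon as they are equal in G.
induce : ∀ {v e p} (G : Graph v e) → Pred (Vertex G) p → Graph (v ⊔ p) e
induce G S = record
  { Vertex = [ x ∈ Vertex G ∣ S x ]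
  ; Adj    = λ x y → Adj (value x) (value y)
  ; sym    = sym
  ; irrefl = irrefl
  }
  where open Graph G using (Adj; sym; irrefl)

-- P has at least as many elements as I.
AtLeast : ∀ {i a p} {A : Set a} (I : Set i) (P : Pred A p) → Set (i ⊔ a ⊔ p)
AtLeast {A = A} I P = Σ[ f ∈ (I → A) ] Injective _≡_ _≡_ f × (∀ i → P (f i))

-- P has exactly k elements.
Exactly : ∀ {a p} {A : Set a} (k : ℕ) (P : Pred A p) → Set (a ⊔ p)
Exactly {A = A} k P =
  Σ[ f ∈ (Fin k → A) ] Injective _≡_ _≡_ f × (∀ x → P x ⇔ (∃[ i ] f i ≡ x))

Infinite : ∀ {a p} {A : Set a} → Pred A p → Set (a ⊔ p)
Infinite P = AtLeast ℕ P

Range : ∀ {i a} {I : Set i} {A : Set a} → (I → A) → Pred A (i ⊔ a)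
Range f x = ∃[ i ] f i ≡ x

module _ {v e} (G : Graph v e) where
  open Graph G using (Adj)

  private
    V : Set v
    V = Vertex G

  -- A path with n edges.
  record Path (x y : V) (n : ℕ) : Set (v ⊔ e) where
    field
      vertex    : Fin (suc n) → V
      injective : Injective _≡_ _≡_ vertex
      start     : vertex zero ≡ x
      end       : vertex (fromℕ n) ≡ y
      step      : ∀ (i : Fin n) → Adj (vertex (inject₁ i)) (vertex (suc i))

  Connected : Set (v ⊔ e)
  Connected = ∀ x y → ∃[ n ] Path x y n

  -- Distances take values in ℕ ⁺, that is, ℕ with a top element ⊤⁺ for ∞.  The
  -- distance is a relation, since its value cannot be computed in general.
  IsDistance : V → V → ℕ ⁺ → Set (v ⊔ e)
  IsDistance x y [ n ] = Path x y n × (∀ m → Path x y m → n ≤ m)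
  IsDistance x y ⊤⁺    = ∀ n → ¬ Path x y n

  BoundsDistances : ∀ {p} → Pred V p → ℕ ⁺ → Set (v ⊔ e ⊔ p)
  BoundsDistances X b = ∀ x y → X x → X y → ∀ d → IsDistance x y d → d ≤⁺ b

  IsDiameter : ∀ {p} → Pred V p → ℕ ⁺ → Set (v ⊔ e ⊔ p)
  IsDiameter X d = BoundsDistances X d × (∀ b → BoundsDistances X b → d ≤⁺ b)

  HasInfiniteDiameter : ∀ {p} → Pred V p → Set (v ⊔ e ⊔ p)
  HasInfiniteDiameter X = IsDiameter X ⊤⁺

  Degree≥ : ℕ → Pred V (v ⊔ e)
  Degree≥ k x = AtLeast (Fin k) (Adj x)

  HasDegree : ℕ → Pred V (v ⊔ e)
  HasDegree k x = Exactly k (Adj x)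

  IsInfiniteInducedPath : (ℕ → V) → Set (v ⊔ e)
  IsInfiniteInducedPath x =
    Injective _≡_ _≡_ x × (∀ i j → Adj (x i) (x j) ⇔ ∣ i - j ∣ ≡ 1)

  -- The vertices are numbered by an interval of ℤ, which may be empty, finite,
  -- infinite in one direction, or infinite in both.
  IsPath : Set (v ⊔ e)
  IsPath = Σ[ f ∈ (V → ℤ) ]
      Injective _≡_ _≡_ f
    × (∀ x y k → f x ℤ.≤ k → k ℤ.≤ f y → Range f k)
    × (∀ x y → Adj x y ⇔ ℤ.∣ f x ℤ.- f y ∣ ≡ 1)

module _ {v e} (G : Graph v e) where
  open Graph G using (Adj)

  private
    V : Set v
    V = Vertex G

  IsCaterpillar : Set (v ⊔ e)
  IsCaterpillar = Connected G × IsPath (induce G (λ x → ¬ HasDegree G 1 x))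

  IsComb : Set (v ⊔ e)
  IsComb = IsCaterpillar ×
    (∀ x y z → Adj x y → HasDegree G 1 y → Adj x z → HasDegree G 1 z → y ≡ z)

  module _ (x : ℕ → V) where

    -- The vertices that are added to the path x.
    Added : Pred V v
    Added y = ∀ i → y ≢ x i

    Neighbours₁ Neighbours₂ Neighbours₃ : V → ℕ → Set e
    Neighbours₁ y i = ∀ j → Adj y (x j) ⇔ (j ≡ i ⊎ j ≡ i + 1)
    Neighbours₂ y i = ∀ j → Adj y (x j) ⇔ (j ≡ i ⊎ j ≡ i + 1 ⊎ j ≡ i + 2)
    Neighbours₃ y i = ∀ j → Adj y (x j) ⇔ (j ≡ i ⊎ j ≡ i + 2)

    Spaced : (V → ℕ → Set e) → Set (v ⊔ e)
    Spaced N = ∀ y y′ → Added y → Added y′ → y ≢ y′ →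
      ∀ i i′ → N y i → N y′ i′ → i + 2 ≤ i′ ⊎ i′ + 2 ≤ i

    KiteType₁ KiteType₂ KiteType₃ : Set (v ⊔ e)
    KiteType₁ =
        (∀ y → Added y → ∃[ i ] Neighbours₁ y i)
      × (∀ y y′ → Added y → Added y′ → y ≢ y′ → ∀ i j →
           Adj y (x i) → Adj y′ (x i) → Adj y (x j) → Adj y′ (x j) → i ≡ j)
    KiteType₂ = (∀ y → Added y → ∃[ i ] Neighbours₂ y i) × Spaced Neighbours₂
    KiteType₃ = (∀ y → Added y → ∃[ i ] Neighbours₃ y i) × Spaced Neighbours₃

  IsKite : Set (v ⊔ e)
  IsKite = Σ[ x ∈ (ℕ → V) ]
      IsInfiniteInducedPath G x
    × (∀ y y′ → Added x y → Added x y′ → ¬ Adj y y′)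
    × (KiteType₁ x ⊎ KiteType₂ x ⊎ KiteType₃ x)

{-# OPTIONS --safe #-}
module Submission where

-- Fix x and call d(u, x) the level of u.  An element strictly above x at level l
-- lies above every element of level at most l - 2, because a walk from x to the
-- larger of two comparable elements has to pass next to the smaller one.  Hence
-- geodesics can be spliced: given geodesics from x to higher and higher targets
-- (upwards, say), follow the k-th one up to a prescribed level and leave it as soon
-- as it touches the next one.  This gives an induced path P of unbounded level.
-- Around the levels far from the splices P is a piece of a geodesic, so a vertex
-- off P at such a level has its neighbours on P among three consecutive vertices.
-- Every vertex of degree at least 3 above x is on P or next to it, which provides
-- infinitely many vertices off P that touch P, far apart; infinitely many of them
-- touch P in the same pattern, and P with these is a comb or a kite.

open import Defs
open import Axiom.ExcludedMiddle using (ExcludedMiddle)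
open import Data.Empty using (⊥; ⊥-elim; ⊥-elim-irr)
open import Data.Fin.Base using (Fin; zero; suc; fromℕ; inject₁; toℕ)
open import Data.Integer.Base as ℤ using (ℤ)
open import Data.Integer.Properties using (+-injective; m-n≡m⊖n; ∣⊖∣-≤; ∣m⊖n∣≡∣n⊖m∣)
open import Data.Irrelevant using ([_])
open import Data.Nat.Base
  using (ℕ; zero; suc; pred; _+_; _∸_; ∣_-_∣; _≤_; _<_; _≤′_; _<′_; ≤′-refl; ≤′-step;
         <′-base; <′-step; z≤n; s≤s; s≤s⁻¹)
open import Data.Nat.GeneralisedArithmetic using (fold)
open import Data.Nat.Properties
open import Data.Product.Base using (Σ-syntax; ∃-syntax; _×_; _,_; proj₁; proj₂)
open import Data.Refinement using (value; value-injective) renaming (_,_ to _,ᵣ_)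
open import Data.Sum.Base using (_⊎_; inj₁; inj₂)
open import Function.Base using (_∘_; case_of_)
open import Function.Bundles using (_⇔_; mk⇔; Equivalence)
open import Function.Definitions using (Injective)
open import Level using (Lift; lift; lower; _⊔_)
open import Relation.Binary.Construct.Add.Supremum.NonStrict _≤_
  using (_≤⁺_; [_]; _≤⊤⁺; [≤]-injective)
open import Relation.Binary.Core using (Rel)
open import Relation.Binary.Definitions using (Transitive; tri<; tri≈; tri>)
open import Relation.Binary.PropositionalEquality.Core
  using (_≡_; _≢_; refl; sym; trans; cong; subst; subst₂)
open import Relation.Binary.Structures using (IsPartialOrder)
open import Relation.Nullary.Construct.Add.Supremum using ([_]; ⊤⁺)
open import Relation.Nullary.Decidable.Core using (yes; no; map′)
open import Relation.Nullary.Negation.Core using (¬_; contradiction)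
open import Relation.Unary using (Pred; U)

-- Classical principles, mostly on the natural numbers.

lower-em : ∀ {a} b → ExcludedMiddle (a ⊔ b) → ExcludedMiddle a
lower-em b em {P} = map′ lower lift (em {Lift b P})

module Classical {a} (em : ExcludedMiddle a) where

  least : (P : ℕ → Set a) → ∀ n → P n → ∃[ m ] P m × (∀ k → P k → m ≤ k)
  least P zero    p = zero , p , λ _ _ → z≤n
  least P (suc n) p with em {P zero}
  ... | yes p₀ = zero , p₀ , λ _ _ → z≤n
  ... | no ¬p₀ with least (P ∘ suc) n p
  ...   | m , pm , min = suc m , pm ,
    λ { zero p₀ → contradiction p₀ ¬p₀ ; (suc k) pk → s≤s (min k pk) }

  greatest : (P : ℕ → Set a) → ∀ b → (∀ k → P k → k ≤ b) → ∀ n → P n →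
    ∃[ m ] P m × (∀ k → P k → k ≤ m)
  greatest P zero    ub n p = n , p , λ k pk → ≤-trans (ub k pk) z≤n
  greatest P (suc b) ub n p with em {P (suc b)}
  ... | yes pb = suc b , pb , ub
  ... | no ¬pb = greatest P b ub′ n p
    where
    ub′ : ∀ k → P k → k ≤ b
    ub′ k pk with m≤n⇒m<n∨m≡n (ub k pk)
    ... | inj₁ k<1+b = s≤s⁻¹ k<1+b
    ... | inj₂ refl  = contradiction pk ¬pb

  subsequence : (P : ℕ → Set a) → (∀ n → ∃[ k ] n ≤ k × P k) →
    ∃[ f ] (∀ {i j} → i < j → f i < f j) × (∀ i → P (f i))
  subsequence P often = f , (λ i<j → f-mono (<⇒<′ i<j)) , holds
    where
    f : ℕ → ℕ
    f zero    = proj₁ (often zero)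
    f (suc i) = proj₁ (often (suc (f i)))

    f-mono : ∀ {i j} → i <′ j → f i < f j
    f-mono (<′-base)         = proj₁ (proj₂ (often _))
    f-mono (<′-step {n} i<j) = <-trans (f-mono i<j) (proj₁ (proj₂ (often (suc (f n)))))

    holds : ∀ i → P (f i)
    holds zero    = proj₂ (proj₂ (often zero))
    holds (suc i) = proj₂ (proj₂ (often (suc (f i))))

  -- Infinite pigeonhole: either `P` fails from some point on and a shift works, or it holds
  -- arbitrarily late. It later makes all attached vertices touch the path in one pattern.
  homogeneous : (P : ℕ → Set a) →
    ∃[ f ] (∀ {i j} → i < j → f i < f j) × ((∀ i → P (f i)) ⊎ (∀ i → ¬ P (f i)))
  homogeneous P with em {∃[ n ] (∀ k → n ≤ k → ¬ P k)}
  ... | yes (n , never) = n +_ , +-monoʳ-< n , inj₂ λ i → never (n + i) (m≤m+n n i)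
  ... | no ¬never =
    let f , mono , holds = subsequence P often in f , mono , inj₁ holds
    where
    often : ∀ n → ∃[ k ] n ≤ k × P k
    often n with em {∃[ k ] n ≤ k × P k}
    ... | yes found = found
    ... | no ¬found = contradiction (n , λ k n≤k pk → ¬found (k , n≤k , pk)) ¬never

-- Walks and shortest paths.

module Walks {v e} (G : Graph v e) where
  open Graph G using (Adj) renaming (sym to ~-sym)

  infixr 5 _∷_ _++_

  -- Unlike a `Path`, a walk may repeat vertices, so concatenation and reversal are free.
  data Walk : Vertex G → Vertex G → ℕ → Set (v ⊔ e) where
    []  : ∀ {x} → Walk x x 0
    _∷_ : ∀ {x y z n} → Adj x y → Walk y z n → Walk x z (suc n)

  _++_ : ∀ {x y z m n} → Walk x y m → Walk y z n → Walk x z (m + n)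
  []      ++ w′ = w′
  (a ∷ w) ++ w′ = a ∷ (w ++ w′)

  reverse : ∀ {x y n} → Walk x y n → Walk y x n
  reverse []              = []
  reverse (_∷_ {n = n} a w) = subst (Walk _ _) (+-comm n 1) (reverse w ++ (~-sym a ∷ []))

  visit : ∀ {x y n} → Walk x y n → Fin (suc n) → Vertex G
  visit {x} w       zero    = x
  visit     (_ ∷ w) (suc i) = visit w i

  visit-last : ∀ {x y n} (w : Walk x y n) → visit w (fromℕ n) ≡ y
  visit-last []      = refl
  visit-last (_ ∷ w) = visit-last w

  visit-step : ∀ {x y n} (w : Walk x y n) i → Adj (visit w (inject₁ i)) (visit w (suc i))
  visit-step (a ∷ w) zero    = a
  visit-step (_ ∷ w) (suc i) = visit-step w i

  suffix : ∀ {x y n} (w : Walk x y n) i → Walk (visit w i) y (n ∸ toℕ i)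
  suffix w       zero    = w
  suffix (_ ∷ w) (suc i) = suffix w i

  Shortest : Vertex G → Vertex G → ℕ → Set (v ⊔ e)
  Shortest x y n = ∀ k → Walk x y k → n ≤ k

  -- Between two visits to the same vertex the walk could be cut short.
  visit-injective : ∀ {x y n} (w : Walk x y n) → Shortest x y n →
    Injective _≡_ _≡_ (visit w)
  visit-injective w       min {zero}  {zero}  _  = refl
  visit-injective (a ∷ w) min {zero}  {suc j} eq =
    contradiction (min _ (subst (λ u → Walk u _ _) (sym eq) (suffix w j)))
                  (<⇒≱ (s≤s (m∸n≤m _ (toℕ j))))
  visit-injective (a ∷ w) min {suc i} {zero}  eq =
    contradiction (min _ (subst (λ u → Walk u _ _) eq (suffix w i)))
                  (<⇒≱ (s≤s (m∸n≤m _ (toℕ i))))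
  visit-injective (a ∷ w) min {suc i} {suc j} eq =
    cong suc (visit-injective w (λ k w′ → s≤s⁻¹ (min _ (a ∷ w′))) eq)

  shortest⇒path : ∀ {x y n} → Walk x y n → Shortest x y n → Path G x y n
  shortest⇒path w min = record
    { vertex    = visit w
    ; injective = visit-injective w min
    ; start     = refl
    ; end       = visit-last w
    ; step      = visit-step w
    }

  path⇒walk : ∀ {x y n} → Path G x y n → Walk x y n
  path⇒walk {x} {y} {n} π = subst₂ (λ x y → Walk x y n) start end (along n vertex step)
    where
    open Path π
    along : ∀ n (s : Fin (suc n) → Vertex G) → (∀ i → Adj (s (inject₁ i)) (s (suc i))) →
      Walk (s zero) (s (fromℕ n)) n
    along zero    s st = []
    along (suc n) s st = st zero ∷ along n (s ∘ suc) (st ∘ suc)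

  module _ (em : ExcludedMiddle (v ⊔ e)) where
    open Classical em

    walk⇒path : ∀ {x y n} → Walk x y n → ∃[ k ] k ≤ n × Path G x y k
    walk⇒path {x} {y} {n} w =
      let k , w′ , min = least (Walk x y) n w in k , min n w , shortest⇒path w′ min

    walks⇒connected : ∀ o → (∀ x → ∃[ n ] Walk x o n) → Connected G
    walks⇒connected o to x y =
      let _ , w  = to x
          _ , w′ = to y
          k , _ , π = walk⇒path (w ++ reverse w′)
      in k , π

-- Distance to a base vertex, and infinite diameter in terms of it.

module Distance {v e} (em : ExcludedMiddle (v ⊔ e)) (G : Graph v e)
  (connected : Connected G) (x : Vertex G) where
  open Graph G using (Adj) renaming (sym to ~-sym)
  open Walks G
  open Classical em

  private
    shortest : ∀ u → ∃[ n ] Walk u x n × Shortest u x n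
    shortest u = let n , π = connected u x in least (Walk u x) n (path⇒walk π)

  abstract
    level : Vertex G → ℕ
    level u = proj₁ (shortest u)

    level-walk : ∀ u → Walk u x (level u)
    level-walk u = proj₁ (proj₂ (shortest u))

    level-least : ∀ {u n} → Walk u x n → level u ≤ n
    level-least {u} w = proj₂ (proj₂ (shortest u)) _ w

  level-distance : ∀ u → IsDistance G u x [ level u ]
  level-distance u = shortest⇒path (level-walk u) (λ _ → level-least)
                   , λ _ π → level-least (path⇒walk π)

  level-origin : level x ≡ 0
  level-origin = n≤0⇒n≡0 (level-least [])

  level≡0⇒origin : ∀ {u} → level u ≡ 0 → u ≡ x
  level≡0⇒origin {u} eq with subst (Walk u x) eq (level-walk u)
  ... | [] = refl

  level-adj : ∀ {u w} → Adj u w → level u ≤ suc (level w)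
  level-adj a = level-least (a ∷ level-walk _)

  -- The witness is the second vertex of a shortest walk to `x`. At level 0 it defaults to `x`,
  -- which fits `pred 0 = 0`; this keeps the operation total, so it can be iterated.
  descend : ∀ u → ∃[ w ] level w ≡ pred (level u) × (0 < level u → Adj w u)
  descend u = go (level-walk u) refl
    where
    go : ∀ {n} → Walk u x n → n ≡ level u →
      ∃[ w ] level w ≡ pred (level u) × (0 < level u → Adj w u)
    go []      eq = x , trans level-origin (cong pred eq) , λ 0<ℓ → contradiction eq (<⇒≢ 0<ℓ)
    go (_∷_ {y = w} a ws) eq = w
      , ≤-antisym (subst (λ k → level w ≤ pred k) eq (level-least ws))
                  (pred-mono-≤ (level-adj a))
      , λ _ → ~-sym a

  Unbounded : ∀ {p} → Pred (Vertex G) p → Set (v ⊔ p)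
  Unbounded X = ∀ n → ∃[ u ] X u × n ≤ level u

  -- Since `x` lies in `X`, the levels of the vertices of `X` are themselves distances within `X`.
  unbounded⇒infinite : ∀ {p} {X : Pred (Vertex G) p} → X x → Unbounded X →
    HasInfiniteDiameter G X
  unbounded⇒infinite Xx far = (λ _ _ _ _ d _ → d ≤⊤⁺) , least-bound
    where
    least-bound : ∀ b → BoundsDistances G _ b → ⊤⁺ ≤⁺ b
    least-bound ⊤⁺    _      = ⊤⁺ ≤⊤⁺
    least-bound [ n ] bounds =
      let u , Xu , n<ℓ = far (suc n)
      in contradiction ([≤]-injective (bounds u x Xu Xx _ (level-distance u))) (<⇒≱ n<ℓ)

  -- Going through `x`, two vertices of level at most `n` are at distance at most `n + n`.
  infinite⇒unbounded : ∀ {p} {X : Pred (Vertex G) p} → ExcludedMiddle (v ⊔ p) →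
    HasInfiniteDiameter G X → Unbounded X
  infinite⇒unbounded {X = X} em′ (_ , least-bound) n with em′ {∃[ u ] X u × n ≤ level u}
  ... | yes far = far
  ... | no ¬far = case least-bound [ n + n ] bounds of λ ()
    where
    near : ∀ {u} → X u → level u ≤ n
    near {u} Xu with ≤-total n (level u)
    ... | inj₁ n≤ℓ = contradiction (u , Xu , n≤ℓ) ¬far
    ... | inj₂ ℓ≤n = ℓ≤n

    bounds : BoundsDistances G X [ n + n ]
    bounds u w Xu Xw ⊤⁺    d         = let k , π = connected u w in contradiction π (d k)
    bounds u w Xu Xw [ k ] (_ , min) =
      let j , j≤ , π = walk⇒path em (level-walk u ++ reverse (level-walk w))
      in [ ≤-trans (min j π) (≤-trans j≤ (+-mono-≤ (near Xu) (near Xw))) ]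

-- Infinite induced paths and consecutive indices.

∣n-1+n∣≡1 : ∀ n → ∣ n - suc n ∣ ≡ 1
∣n-1+n∣≡1 zero    = refl
∣n-1+n∣≡1 (suc n) = ∣n-1+n∣≡1 n

∣m-n∣≡1⇒consecutive : ∀ m n → ∣ m - n ∣ ≡ 1 → n ≡ suc m ⊎ m ≡ suc n
∣m-n∣≡1⇒consecutive zero    n       eq = inj₁ eq
∣m-n∣≡1⇒consecutive (suc m) zero    eq = inj₂ eq
∣m-n∣≡1⇒consecutive (suc m) (suc n) eq with ∣m-n∣≡1⇒consecutive m n eq
... | inj₁ n≡1+m = inj₁ (cong suc n≡1+m)
... | inj₂ m≡1+n = inj₂ (cong suc m≡1+n)

∣+m-+n∣≡∣m-n∣ : ∀ m n → ℤ.∣ ℤ.+ m ℤ.- ℤ.+ n ∣ ≡ ∣ m - n ∣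
∣+m-+n∣≡∣m-n∣ m n = trans (cong ℤ.∣_∣ (m-n≡m⊖n m n)) (∣⊖∣ (≤-total m n))
  where
  ∣⊖∣ : m ≤ n ⊎ n ≤ m → ℤ.∣ m ℤ.⊖ n ∣ ≡ ∣ m - n ∣
  ∣⊖∣ (inj₁ m≤n) = trans (∣⊖∣-≤ m≤n) (sym (m≤n⇒∣m-n∣≡n∸m m≤n))
  ∣⊖∣ (inj₂ n≤m) = trans (∣m⊖n∣≡∣n⊖m∣ m n)
    (trans (∣⊖∣-≤ n≤m) (sym (m≤n⇒∣n-m∣≡n∸m n≤m)))

module _ {v e} (G : Graph v e) where
  open Graph G using (Adj; irrefl) renaming (sym to ~-sym)

  module _ {p : ℕ → Vertex G} (adj : ∀ i → Adj (p i) (p (suc i)))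
    (nonadj : ∀ {i j} → 2 + i ≤ j → ¬ Adj (p i) (p j)) where

    -- Distinctness is a consequence of `nonadj`: if `p i ≡ p j` with `i < j`, then `p i` is
    -- adjacent to `p (suc j)`, at least two steps later.
    infiniteInducedPath : IsInfiniteInducedPath G p
    infiniteInducedPath = injective , λ i j → mk⇔ (gap i j) (edge i j)
      where
      distinct : ∀ {i j} → i < j → p i ≢ p j
      distinct {j = j} i<j eq =
        nonadj (s≤s i<j) (subst (λ u → Adj u (p (suc j))) (sym eq) (adj j))

      injective : Injective _≡_ _≡_ p
      injective {i} {j} eq with <-cmp i j
      ... | tri< i<j _ _  = contradiction eq (distinct i<j)
      ... | tri≈ _ i≡j _  = i≡j
      ... | tri> _ _ j<i  = contradiction (sym eq) (distinct j<i)

      gap< : ∀ {i j} → i < j → Adj (p i) (p j) → ∣ i - j ∣ ≡ 1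
      gap< {i} i<j a with m≤n⇒m<n∨m≡n i<j
      ... | inj₁ 2+i≤j = contradiction a (nonadj 2+i≤j)
      ... | inj₂ refl  = ∣n-1+n∣≡1 i

      gap : ∀ i j → Adj (p i) (p j) → ∣ i - j ∣ ≡ 1
      gap i j a with <-cmp i j
      ... | tri< i<j _ _  = gap< i<j a
      ... | tri≈ _ refl _ = contradiction a irrefl
      ... | tri> _ _ j<i  = trans (∣-∣-comm i j) (gap< j<i (~-sym a))

      edge : ∀ i j → ∣ i - j ∣ ≡ 1 → Adj (p i) (p j)
      edge i j eq with ∣m-n∣≡1⇒consecutive i j eq
      ... | inj₁ refl = adj i
      ... | inj₂ refl = ~-sym (adj j)

-- Combs and kites from an induced path with vertices attached to it.

module Attachments {v e} (em : ExcludedMiddle (v ⊔ e)) (G : Graph v e)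
  (p : ℕ → Vertex G) (induced : IsInfiniteInducedPath G p) where
  open Graph G using (Adj; irrefl) renaming (sym to ~-sym)

  p-injective : Injective _≡_ _≡_ p
  p-injective = proj₁ induced

  p-adj : ∀ i → Adj (p i) (p (suc i))
  p-adj i = Equivalence.from (proj₂ induced i (suc i)) (∣n-1+n∣≡1 i)

  p-consecutive : ∀ {i j} → Adj (p i) (p j) → j ≡ suc i ⊎ i ≡ suc j
  p-consecutive {i} {j} a =
    ∣m-n∣≡1⇒consecutive i j (Equivalence.to (proj₂ induced i j) a)

  -- The first neighbour of q k on the path has index t k.
  record Teeth : Set (v ⊔ e) where
    field
      q      : ℕ → Vertex G
      t      : ℕ → ℕ
      q∉p    : ∀ k j → q k ≢ p j
      touch  : ∀ k → Adj (q k) (p (t k))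
      window : ∀ {k j} → Adj (q k) (p j) → j ≡ t k ⊎ j ≡ t k + 1 ⊎ j ≡ t k + 2
      apart  : ∀ {k k′ j j′} → k < k′ → Adj (q k) (p j) → Adj (q k′) (p j′) → j < j′
      indep  : ∀ k k′ → ¬ Adj (q k) (q k′)
      far    : ∀ k → 2 ≤ t k

  restrict : (f : ℕ → ℕ) → (∀ {i j} → i < j → f i < f j) → Teeth → Teeth
  restrict f f-mono T = record
    { q      = q ∘ f
    ; t      = t ∘ f
    ; q∉p    = λ k → q∉p (f k)
    ; touch  = λ k → touch (f k)
    ; window = window
    ; apart  = λ k<k′ → apart (f-mono k<k′)
    ; indep  = λ k k′ → indep (f k) (f k′)
    ; far    = λ k → far (f k)
    }
    where open Teeth T

  module Subgraph (T : Teeth) where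
    open Teeth T

    -- The lift places membership at the universe level for which excluded middle is assumed.
    S : Pred (Vertex G) (v ⊔ e)
    S u = Lift e (Range p u ⊎ Range q u)

    H : Graph (v ⊔ e) e
    H = induce G S

    P Q : ℕ → Vertex H
    P j = p j ,ᵣ [ lift (inj₁ (j , refl)) ]
    Q k = q k ,ᵣ [ lift (inj₂ (k , refl)) ]

    -- The membership proof carried by `u` is irrelevant and cannot be inspected. Membership is
    -- therefore decided afresh, and the irrelevant proof only refutes the negative answer.
    cover : ∀ u → Range P u ⊎ Range Q u
    cover (u ,ᵣ [ s ]) with em {S u}
    ... | yes (lift (inj₁ (j , refl))) = inj₁ (j , refl)
    ... | yes (lift (inj₂ (k , refl))) = inj₂ (k , refl)
    ... | no ¬s                        = ⊥-elim-irr (¬s s)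

    owner-unique : ∀ {k k′ j} → Adj (q k) (p j) → Adj (q k′) (p j) → k ≡ k′
    owner-unique {k} {k′} a a′ with <-cmp k k′
    ... | tri< k<k′ _ _ = contradiction (apart k<k′ a a′) (<-irrefl refl)
    ... | tri≈ _ eq _   = eq
    ... | tri> _ _ k′<k = contradiction (apart k′<k a′ a) (<-irrefl refl)

    P-injective : Injective _≡_ _≡_ P
    P-injective eq = p-injective (cong value eq)

    -- The vertex where a tooth is attached has that tooth and two path neighbours; `far` keeps it
    -- away from the end of the path.
    branching : Infinite (Degree≥ H 3)
    branching = P ∘ t
              , (λ eq → owner-unique (touch _)
                  (subst (Adj (q _) ∘ p) (sym (P-injective eq)) (touch _)))
              , λ k → degree≥3 (t k) (far k) (~-sym (touch k))
      where
      degree≥3 : ∀ {k} i → 2 ≤ i → Adj (p i) (q k) → Degree≥ H 3 (P i)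
      degree≥3 {k} (suc i) _ a = f , f-injective , f-adj
        where
        f : Fin 3 → Vertex H
        f zero             = P i
        f (suc zero)       = P (2 + i)
        f (suc (suc zero)) = Q k

        i≢2+i : i ≢ 2 + i
        i≢2+i = <⇒≢ (m<n+m i (s≤s z≤n))

        Q≢P : ∀ j → Q k ≢ P j
        Q≢P j eq = q∉p k j (cong value eq)

        f-injective : Injective _≡_ _≡_ f
        f-injective {zero}           {zero}           _  = refl
        f-injective {zero}           {suc zero}       eq = contradiction (P-injective eq) i≢2+i
        f-injective {zero}           {suc (suc zero)} eq = contradiction (sym eq) (Q≢P i)
        f-injective {suc zero}       {zero}           eq = contradiction (sym (P-injective eq)) i≢2+i
        f-injective {suc zero}       {suc zero}       _  = refl
        f-injective {suc zero}       {suc (suc zero)} eq = contradiction (sym eq) (Q≢P (2 + i))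
        f-injective {suc (suc zero)} {zero}           eq = contradiction eq (Q≢P i)
        f-injective {suc (suc zero)} {suc zero}       eq = contradiction eq (Q≢P (2 + i))
        f-injective {suc (suc zero)} {suc (suc zero)} _  = refl

        f-adj : ∀ i → Graph.Adj H (P _) (f i)
        f-adj zero             = ~-sym (p-adj i)
        f-adj (suc zero)       = p-adj (suc i)
        f-adj (suc (suc zero)) = a

    added : ∀ {u} → Added H P u → Range Q u
    added {u} u∉P with cover u
    ... | inj₁ (j , Pj≡u) = contradiction (sym Pj≡u) (u∉P j)
    ... | inj₂ Q∋u        = Q∋u

    kite : KiteType₁ H P ⊎ KiteType₂ H P ⊎ KiteType₃ H P → IsKite H
    kite types = P , (P-injective , proj₂ induced) , independent , types
      where
      independent : ∀ y y′ → Added H P y → Added H P y′ → ¬ Graph.Adj H y y′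
      independent y y′ y∉P y′∉P with added y∉P | added y′∉P
      ... | k , refl | k′ , refl = indep k k′

    -- Serves types 2 and 3 alike: `apart` compares the last neighbour of the earlier tooth with the
    -- first neighbour of the later one.
    spaced : (N : Vertex H → ℕ → Set e) →
      (∀ {y i} → N y i → Graph.Adj H y (P i) × Graph.Adj H y (P (i + 2))) → Spaced H P N
    spaced N ends y y′ y∉P y′∉P y≢y′ i i′ Nyi Ny′i′ with added y∉P | added y′∉P
    ... | k , refl | k′ , refl with <-cmp k k′
    ...   | tri< k<k′ _ _ = inj₁ (<⇒≤ (apart k<k′ (proj₂ (ends Nyi)) (proj₁ (ends Ny′i′))))
    ...   | tri≈ _ refl _ = contradiction refl y≢y′
    ...   | tri> _ _ k′<k = inj₂ (<⇒≤ (apart k′<k (proj₂ (ends Ny′i′)) (proj₁ (ends Nyi))))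

    module Second (second : ∀ k → Adj (q k) (p (t k + 1))) where

      kite₁ : (∀ k → ¬ Adj (q k) (p (t k + 2))) → IsKite H
      kite₁ ¬third = kite (inj₁ (neighbours , at-most-one))
        where
        neighbours : ∀ y → Added H P y → ∃[ i ] Neighbours₁ H P y i
        neighbours y y∉P with added y∉P
        ... | k , refl = t k , λ j → mk⇔ (to j) λ { (inj₁ refl) → touch k ; (inj₂ refl) → second k }
          where
          to : ∀ j → Adj (q k) (p j) → j ≡ t k ⊎ j ≡ t k + 1
          to j a with window a
          ... | inj₁ eq          = inj₁ eq
          ... | inj₂ (inj₁ eq)   = inj₂ eq
          ... | inj₂ (inj₂ refl) = contradiction a (¬third k)

        at-most-one : ∀ y y′ → Added H P y → Added H P y′ → y ≢ y′ → ∀ i j →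
          Graph.Adj H y (P i) → Graph.Adj H y′ (P i) →
          Graph.Adj H y (P j) → Graph.Adj H y′ (P j) → i ≡ j
        -- Distinct teeth have no common neighbour on the path at all, so one common neighbour is
        -- already absurd.
        at-most-one y y′ y∉P y′∉P y≢y′ i j a a′ _ _ with added y∉P | added y′∉P
        ... | k , refl | k′ , refl = contradiction (cong Q (owner-unique a a′)) y≢y′

      kite₂ : (∀ k → Adj (q k) (p (t k + 2))) → IsKite H
      kite₂ third = kite (inj₂ (inj₁ (neighbours , spaced (Neighbours₂ H P) λ {_} {i} N →
        Equivalence.from (N i) (inj₁ refl) , Equivalence.from (N (i + 2)) (inj₂ (inj₂ refl)))))
        where
        neighbours : ∀ y → Added H P y → ∃[ i ] Neighbours₂ H P y i
        neighbours y y∉P with added y∉P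
        ... | k , refl = t k , λ j → mk⇔ window λ
          { (inj₁ refl)        → touch k
          ; (inj₂ (inj₁ refl)) → second k
          ; (inj₂ (inj₂ refl)) → third k }

    module ¬Second (¬second : ∀ k → ¬ Adj (q k) (p (t k + 1))) where

      kite₃ : (∀ k → Adj (q k) (p (t k + 2))) → IsKite H
      kite₃ third = kite (inj₂ (inj₂ (neighbours , spaced (Neighbours₃ H P) λ {_} {i} N →
        Equivalence.from (N i) (inj₁ refl) , Equivalence.from (N (i + 2)) (inj₂ refl))))
        where
        neighbours : ∀ y → Added H P y → ∃[ i ] Neighbours₃ H P y i
        neighbours y y∉P with added y∉P
        ... | k , refl = t k , λ j → mk⇔ (to j) λ { (inj₁ refl) → touch k ; (inj₂ refl) → third k }
          where
          to : ∀ j → Adj (q k) (p j) → j ≡ t k ⊎ j ≡ t k + 2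
          to j a with window a
          ... | inj₁ eq          = inj₁ eq
          ... | inj₂ (inj₁ refl) = contradiction a (¬second k)
          ... | inj₂ (inj₂ eq)   = inj₂ eq

      comb : (∀ k → ¬ Adj (q k) (p (t k + 2))) → IsComb H
      comb ¬third = (H-connected , spine) , teeth-unique
        where
        foot : ∀ {k j} → Adj (q k) (p j) → j ≡ t k
        foot {k} a with window a
        ... | inj₁ eq          = eq
        ... | inj₂ (inj₁ refl) = contradiction a (¬second k)
        ... | inj₂ (inj₂ refl) = contradiction a (¬third k)

        open Walks H

        descent : ∀ j → Walk (P j) (P 0) j
        descent zero    = []
        descent (suc j) = ~-sym (p-adj j) ∷ descent j

        H-connected : Connected H
        H-connected = walks⇒connected em (P 0) to
          where
          to : ∀ u → ∃[ n ] Walk u (P 0) n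
          to u with cover u
          ... | inj₁ (j , refl) = j , descent j
          ... | inj₂ (k , refl) = suc (t k) , touch k ∷ descent (t k)

        Leaf : Pred (Vertex H) (v ⊔ e)
        Leaf = HasDegree H 1

        Q-leaf : ∀ k → Leaf (Q k)
        Q-leaf k = (λ _ → P (t k)) , (λ { {zero} {zero} _ → refl })
                 , λ u → mk⇔ (to u) λ { (_ , refl) → touch k }
          where
          to : ∀ u → Graph.Adj H (Q k) u → ∃[ i ] P (t k) ≡ u
          to u a with cover u
          ... | inj₁ (j , refl)  = zero , cong P (sym (foot a))
          ... | inj₂ (k′ , refl) = contradiction a (indep k k′)

        P-¬leaf : ∀ j → ¬ Leaf (P (suc j))
        P-¬leaf j (f , _ , nbrs)
          with Equivalence.to (nbrs (P j)) (~-sym (p-adj j))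
             | Equivalence.to (nbrs (P (2 + j))) (p-adj (suc j))
        ... | zero , eq | zero , eq′ = <⇒≢ (m<n+m j (s≤s z≤n)) (P-injective (trans (sym eq) eq′))

        Spine : Graph (v ⊔ e) e
        Spine = induce H (λ u → ¬ Leaf u)

        on-path : ∀ (u : Vertex Spine) → ∃[ j ] P j ≡ value u
        on-path (u ,ᵣ [ ¬leaf ]) with cover u
        ... | inj₁ P∋u        = P∋u
        ... | inj₂ (k , refl) = ⊥-elim-irr (¬leaf (Q-leaf k))

        index : Vertex Spine → ℕ
        index u = proj₁ (on-path u)

        P-index : ∀ u → P (index u) ≡ value u
        P-index u = proj₂ (on-path u)

        spine : IsPath Spine
        spine = (ℤ.+_ ∘ index) , injective , interval , adjacency
          where
          injective : Injective _≡_ _≡_ (ℤ.+_ ∘ index)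
          injective {u} {w} eq = value-injective (trans (sym (P-index u))
            (trans (cong P (+-injective eq)) (P-index w)))

          index-unique : ∀ u j → P j ≡ value u → index u ≡ j
          index-unique u j eq = P-injective (trans (P-index u) (sym eq))

          interval : ∀ u w k → (ℤ.+ index u) ℤ.≤ k → k ℤ.≤ (ℤ.+ index w) → Range (ℤ.+_ ∘ index) k
          interval u w (ℤ.+ k) (ℤ.+≤+ i≤k) _ = reach k (m≤n⇒m<n∨m≡n i≤k)
            where
            -- Whether `P 0` is a leaf is left open: index 0 can only occur as `index u` itself, and
            -- every positive index belongs to a vertex with two path neighbours.
            reach : ∀ k → index u < k ⊎ index u ≡ k → Range (ℤ.+_ ∘ index) (ℤ.+ k)
            reach (suc k) (inj₁ _)  =
              let u′ = P (suc k) ,ᵣ [ P-¬leaf k ] in u′ , cong ℤ.+_ (index-unique u′ (suc k) refl)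
            reach k       (inj₂ eq) = u , cong ℤ.+_ eq

          adjacency : ∀ u w → Graph.Adj Spine u w ⇔ ℤ.∣ ℤ.+ index u ℤ.- ℤ.+ index w ∣ ≡ 1
          adjacency u w = subst₂ (λ a b → Graph.Adj H a b ⇔ ℤ.∣ ℤ.+ index u ℤ.- ℤ.+ index w ∣ ≡ 1)
            (P-index u) (P-index w)
            (subst (λ n → Graph.Adj H (P (index u)) (P (index w)) ⇔ n ≡ 1)
              (sym (∣+m-+n∣≡∣m-n∣ (index u) (index w))) (proj₂ induced (index u) (index w)))

        leaf : ∀ u → Leaf u → u ≡ P 0 ⊎ Range Q u
        leaf u deg1 with cover u
        ... | inj₁ (zero , refl)  = inj₁ refl
        ... | inj₁ (suc j , refl) = contradiction deg1 (P-¬leaf j)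
        ... | inj₂ Q∋u            = inj₂ Q∋u

        neighbour-of-tooth : ∀ u k → Graph.Adj H u (Q k) → u ≡ P (t k)
        neighbour-of-tooth u k a with cover u
        ... | inj₁ (j , refl)  = cong P (foot (~-sym a))
        ... | inj₂ (k′ , refl) = contradiction a (indep k′ k)

        -- `P 0` may be a leaf as well. Its only neighbour on the path is `P 1`, whereas teeth are
        -- attached at index 2 or later; this is where the bound in `far` comes from.
        not-both : ∀ u k → Graph.Adj H u (P 0) → ¬ Graph.Adj H u (Q k)
        not-both u k a b with refl ← neighbour-of-tooth u k b with p-consecutive a
        ... | inj₂ t≡1 = <⇒≢ (far k) (sym t≡1)

        teeth-unique : ∀ u y z → Graph.Adj H u y → Leaf y → Graph.Adj H u z → Leaf z → y ≡ z
        teeth-unique u y z a y-leaf b z-leaf with leaf y y-leaf | leaf z z-leaf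
        ... | inj₁ refl       | inj₁ refl       = refl
        ... | inj₁ refl       | inj₂ (k , refl) = contradiction b (not-both u k a)
        ... | inj₂ (k , refl) | inj₁ refl       = contradiction a (not-both u k b)
        ... | inj₂ (k , refl) | inj₂ (k′ , refl)
          with refl ← neighbour-of-tooth u k a = cong Q (owner-unique {j = t k} (~-sym a) (~-sym b))

  -- Two rounds of pigeonhole fix whether the teeth see the second and the third vertex of their
  -- window. Both: type 2. Only the second: type 1. Only the third: type 3. Neither: a comb.
  comb-or-kite : Teeth → ∃[ T ] (IsComb (Subgraph.H T) ⊎ IsKite (Subgraph.H T))
  comb-or-kite T₀
    with Classical.homogeneous em (λ k → Lift v (Adj (q k) (p (t k + 1))))
    where open Teeth T₀
  ... | f , f-mono , by-second
    with Classical.homogeneous em (λ k → Lift v (Adj (q k) (p (t k + 2))))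
    where open Teeth (restrict f f-mono T₀)
  ...   | g , g-mono , by-third = T , classify by-second by-third
    where
    T : Teeth
    T = restrict g g-mono (restrict f f-mono T₀)
    open Subgraph T

    classify : _ → _ → IsComb H ⊎ IsKite H
    classify (inj₁ second)  (inj₁ third)  =
      inj₂ (Second.kite₂ (lower ∘ second ∘ g) (lower ∘ third))
    classify (inj₁ second)  (inj₂ ¬third) =
      inj₂ (Second.kite₁ (lower ∘ second ∘ g) λ k a → ¬third k (lift a))
    classify (inj₂ ¬second) (inj₁ third)  =
      inj₂ (¬Second.kite₃ (λ k a → ¬second (g k) (lift a)) (lower ∘ third))
    classify (inj₂ ¬second) (inj₂ ¬third) =
      inj₁ (¬Second.comb (λ k a → ¬second (g k) (lift a)) λ k a → ¬third k (lift a))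

-- Levels and geodesics on one side of `x`, for an abstract strict order.

module Upward {v e o} (em : ExcludedMiddle (v ⊔ e)) (G : Graph v e) (connected : Connected G)
  (_⊏_ : Rel (Vertex G) o)
  (⊏-trans : Transitive _⊏_) (⊏-irrefl : ∀ {u} → ¬ u ⊏ u)
  (⊏⇒≁ : ∀ {u w} → u ⊏ w → ¬ Graph.Adj G u w)
  (compare : ∀ u w → u ≡ w ⊎ u ⊏ w ⊎ w ⊏ u ⊎ Graph.Adj G u w)
  (x : Vertex G) where
  open Graph G using (Adj; irrefl) renaming (sym to ~-sym)
  open Walks G
  open Distance em G connected x

  private
    em-v : ExcludedMiddle v
    em-v = lower-em e em

    em-e : ExcludedMiddle e
    em-e = lower-em v em

  -- A walk from `c` to `x` cannot skip past `a`: neighbours are incomparable, so the first vertex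
  -- no longer above `a` is `a` or adjacent to `a`. The rest of the walk then leads from `a` to `x`
  -- in at most `n` steps.
  convex : ∀ {a c} → x ⊏ a → a ⊏ c → level a ≤ level c
  convex = go (level-walk _)
    where
    go : ∀ {n a c} → Walk c x n → x ⊏ a → a ⊏ c → level a ≤ n
    go []                      x⊏a a⊏x = contradiction (⊏-trans x⊏a a⊏x) ⊏-irrefl
    go {a = a} (_∷_ {y = d} c~d w) x⊏a a⊏c with compare a d
    ... | inj₁ refl               = m≤n⇒m≤1+n (level-least w)
    ... | inj₂ (inj₁ a⊏d)         = m≤n⇒m≤1+n (go w x⊏a a⊏d)
    ... | inj₂ (inj₂ (inj₁ d⊏a))  = contradiction (~-sym c~d) (⊏⇒≁ (⊏-trans d⊏a a⊏c))
    ... | inj₂ (inj₂ (inj₂ a~d))  = level-least (a~d ∷ w)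

  -- Two levels of difference exclude equality and adjacency, and `convex` excludes `w ⊏ u`.
  below : ∀ {u w} → x ⊏ w → 2 + level u ≤ level w → u ⊏ w
  below {u} {w} x⊏w gap with compare u w
  ... | inj₁ refl               = contradiction (m≤n+m (level u) 1) (<⇒≱ gap)
  ... | inj₂ (inj₁ u⊏w)         = u⊏w
  ... | inj₂ (inj₂ (inj₁ w⊏u))  = contradiction (m≤n⇒m≤1+n (convex x⊏w w⊏u)) (<⇒≱ gap)
  ... | inj₂ (inj₂ (inj₂ u~w))  = contradiction (level-adj (~-sym u~w)) (<⇒≱ gap)

  -- Read backwards from `s n`, the first vertex not above `a` is adjacent to one that is. Hence it
  -- cannot lie below `a`, and must equal `a` or be adjacent to it.
  crossing : ∀ (s : ℕ → Vertex G) {a} n → (∀ {i} → i < n → Adj (s i) (s (suc i))) →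
    s 0 ⊏ a → a ⊏ s n → ∃[ j ] j ≤ n × (s j ≡ a ⊎ Adj (s j) a)
  crossing s     zero    adj s₀⊏a a⊏s₀ = contradiction (⊏-trans s₀⊏a a⊏s₀) ⊏-irrefl
  crossing s {a} (suc n) adj s₀⊏a a⊏s with compare (s n) a
  ... | inj₁ eq                 = n , n≤1+n n , inj₁ eq
  ... | inj₂ (inj₁ sₙ⊏a)        = contradiction (adj ≤-refl) (⊏⇒≁ (⊏-trans sₙ⊏a a⊏s))
  ... | inj₂ (inj₂ (inj₁ a⊏sₙ)) =
    let j , j≤n , meets = crossing s n (λ i<n → adj (m≤n⇒m≤1+n i<n)) s₀⊏a a⊏sₙ
    in j , m≤n⇒m≤1+n j≤n , meets
  ... | inj₂ (inj₂ (inj₂ sₙ~a)) = n , n≤1+n n , inj₂ sₙ~a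

  -- Values of `at` beyond `n` are arbitrary. The condition `above` starts at 2 because the vertex
  -- at level 1 is adjacent to `x`.
  record Geodesic (n : ℕ) : Set (v ⊔ e ⊔ o) where
    field
      at       : ℕ → Vertex G
      level-at : ∀ {i} → i ≤ n → level (at i) ≡ i
      step-at  : ∀ {i} → i < n → Adj (at i) (at (suc i))
      above    : ∀ {i} → 2 ≤ i → i ≤ n → x ⊏ at i

  above-adj : ∀ {u w} → x ⊏ u → Adj w u → 2 ≤ level w → x ⊏ w
  above-adj {u} {w} x⊏u w~u 2≤ℓ with compare x w
  ... | inj₁ refl               = contradiction level-origin (>⇒≢ (<-trans (s≤s z≤n) 2≤ℓ))
  ... | inj₂ (inj₁ x⊏w)         = x⊏w
  ... | inj₂ (inj₂ (inj₁ w⊏x))  = contradiction w~u (⊏⇒≁ (⊏-trans w⊏x x⊏u))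
  ... | inj₂ (inj₂ (inj₂ x~w))  =
    contradiction (subst (λ n → level w ≤ suc n) level-origin (level-adj (~-sym x~w))) (<⇒≱ 2≤ℓ)

  -- Built backwards: each `descend` from `u` loses one level and, by `above-adj`, stays above `x`
  -- down to level 2. The index is then reversed so that `at i` has level `i`.
  geodesic : ∀ {u n} → x ⊏ u → n ≤ level u → Geodesic n
  geodesic {u} {n} x⊏u n≤ℓ = record
    { at       = λ i → back (level u ∸ i)
    ; level-at = λ {i} i≤n → trans (level-back (level u ∸ i)) (m∸[m∸n]≡n (≤-trans i≤n n≤ℓ))
    ; step-at  = λ {i} i<n → let i<ℓ = ≤-trans i<n n≤ℓ in
        subst (λ d → Adj (back d) (back (level u ∸ suc i))) (sym (+-∸-assoc 1 i<ℓ))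
          (back-adj (∸-monoʳ-< {o = 0} (s≤s z≤n) i<ℓ))
    ; above    = λ {i} 2≤i i≤n → back-above (level u ∸ i)
        (subst (2 ≤_) (sym (m∸[m∸n]≡n (≤-trans i≤n n≤ℓ))) 2≤i)
    }
    where
    back : ℕ → Vertex G
    back = fold u (λ w → proj₁ (descend w))

    level-back : ∀ d → level (back d) ≡ level u ∸ d
    level-back zero    = refl
    level-back (suc d) = trans (proj₁ (proj₂ (descend (back d))))
      (trans (cong pred (level-back d)) (pred[m∸n]≡m∸[1+n] (level u) d))

    back-adj : ∀ {d} → d < level u → Adj (back (suc d)) (back d)
    back-adj {d} d<ℓ = proj₂ (proj₂ (descend (back d)))
      (subst (0 <_) (sym (level-back d)) (m<n⇒0<n∸m d<ℓ))

    back-above : ∀ d → 2 ≤ level u ∸ d → x ⊏ back d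
    back-above zero    _   = x⊏u
    back-above (suc d) 2≤ℓ = above-adj
      (back-above d (≤-trans 2≤ℓ (∸-monoʳ-≤ (level u) (n≤1+n d))))
      (back-adj (<-trans (n<1+n d) (m∸n≢0⇒n<m (>⇒≢ (<-trans (s≤s z≤n) 2≤ℓ)))))
      (subst (2 ≤_) (sym (level-back (suc d))) 2≤ℓ)

  open Geodesic

  -- The induced path spliced from geodesics.

  module Ray (high : ∀ n → ∃[ u ] x ⊏ u × n ≤ level u) where

    -- The k-th geodesic b k is used from about level m k to about level m (suc k);
    -- y k lies six levels or more away from both.
    m : ℕ → ℕ
    m zero    = 0
    m (suc k) = 6 + level (proj₁ (high (6 + m k)))

    y : ℕ → Vertex G
    y k = proj₁ (high (6 + m k))

    x⊏y : ∀ k → x ⊏ y k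
    x⊏y k = proj₁ (proj₂ (high (6 + m k)))

    6+m≤y : ∀ k → 6 + m k ≤ level (y k)
    6+m≤y k = proj₂ (proj₂ (high (6 + m k)))

    m-gap : ∀ k → 12 + m k ≤ m (suc k)
    m-gap k = +-monoʳ-≤ 6 (6+m≤y k)

    m-mono : ∀ {k k′} → k ≤ k′ → m k ≤ m k′
    m-mono k≤k′ = go (≤⇒≤′ k≤k′)
      where
      go : ∀ {k k′} → k ≤′ k′ → m k ≤ m k′
      go ≤′-refl         = ≤-refl
      go (≤′-step {k′} k≤k′) = ≤-trans (go k≤k′) (≤-trans (m≤n+m (m k′) 12) (m-gap k′))

    k≤m : ∀ k → k ≤ m k
    k≤m zero    = z≤n
    k≤m (suc k) = ≤-trans (s≤s (k≤m k)) (≤-trans (m≤n+m (suc (m k)) 11) (m-gap k))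

    -- The level by which `b k` has to be left, one above the start of the next range.
    N : ℕ → ℕ
    N k = suc (m (suc k))

    b : ∀ k → Geodesic (N k)
    b k = let u , x⊏u , N≤ℓ = high (N k) in geodesic x⊏u N≤ℓ

    State : Set
    State = ℕ × ℕ

    vertex : State → Vertex G
    vertex (k , i) = at (b k) i

    -- The upper bound on `j` makes a largest choice exist; the two bounds together are the
    -- invariant `Bounded` for the next segment.
    Reach : ℕ → ℕ → ℕ → Set e
    Reach k i j = m (suc k) ≤ j × j ≤ N (suc k) × Adj (at (b k) i) (at (b (suc k)) j)

    -- Jumping at the first opportunity, and to the highest possible vertex, is what
    -- excludes chords between consecutive geodesics.
    data Step : State → State → Set e where
      jump : ∀ {k i j} → Reach k i j → (∀ j′ → Reach k i j′ → j′ ≤ j) → Step (k , i) (suc k , j)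
      stay : ∀ {k i} → (∀ j → ¬ Reach k i j) → Step (k , i) (k , suc i)

    step : ∀ s → ∃[ s′ ] Step s s′
    step (k , i) with em-e {∃[ j ] Reach k i j}
    ... | no ¬r       = _ , stay (λ j r → ¬r (j , r))
    ... | yes (j , r) =
      let _ , r′ , max = Classical.greatest em-e (Reach k i) (N (suc k)) (λ _ → proj₁ ∘ proj₂) j r
      in _ , jump r′ max

    run : ℕ → State
    run zero    = 0 , 0
    run (suc n) = proj₁ (step (run n))

    run-step : ∀ n → Step (run n) (run (suc n))
    run-step n = proj₂ (step (run n))

    seg idx : ℕ → ℕ
    seg n = proj₁ (run n)
    idx n = proj₂ (run n)

    p : ℕ → Vertex G
    p n = vertex (run n)

    Bounded : State → Set
    Bounded (k , i) = m k ≤ i × i ≤ N k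

    -- The vertex `a` lies above the origin of the next geodesic and, by the two-level gap, below
    -- its vertex at level `3 + M`. So that geodesic must meet `a` in between.
    final-reach : ∀ k → ∃[ j ] Reach k (N k) j
    final-reach k = meet (crossing s (3 + M) (λ i< → step-at c (≤-trans i< 3+M≤)) s₀⊏a a⊏s)
      where
      M : ℕ
      M = m (suc k)

      c : Geodesic (N (suc k))
      c = b (suc k)

      s : ℕ → Vertex G
      s = at c

      a : Vertex G
      a = at (b k) (N k)

      2≤M : 2 ≤ M
      2≤M = ≤-trans (m≤m+n 2 (10 + m k)) (m-gap k)

      3+M≤ : 3 + M ≤ N (suc k)
      3+M≤ = ≤-trans (m≤n+m (3 + M) 10) (s≤s (m-gap (suc k)))

      level-a : level a ≡ suc M
      level-a = level-at (b k) ≤-refl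

      s₀⊏a : s 0 ⊏ a
      s₀⊏a = subst (_⊏ a) (sym (level≡0⇒origin (level-at c z≤n)))
        (above (b k) (m≤n⇒m≤1+n 2≤M) ≤-refl)

      a⊏s : a ⊏ s (3 + M)
      a⊏s = below (above c (s≤s (s≤s z≤n)) 3+M≤)
        (subst₂ (λ l l′ → 2 + l ≤ l′) (sym level-a) (sym (level-at c 3+M≤)) ≤-refl)

      meet : ∃[ j ] j ≤ 3 + M × (s j ≡ a ⊎ Adj (s j) a) → ∃[ j ] Reach k (N k) j
      meet (j , j≤ , inj₂ sj~a) = j
        , s≤s⁻¹ (subst₂ (λ l l′ → l ≤ suc l′) level-a (level-at c (≤-trans j≤ 3+M≤))
            (level-adj (~-sym sj~a)))
        , ≤-trans j≤ 3+M≤ , ~-sym sj~a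
      -- If the next geodesic runs through `a`, comparing levels gives `j = suc M`, and its
      -- following vertex is a neighbour of `a`.
      meet (j , j≤ , inj₁ sj≡a)
        with trans (sym (level-at c (≤-trans j≤ 3+M≤))) (trans (cong level sj≡a) level-a)
      ... | refl = suc (suc M) , m≤n+m M 2 , ≤-trans (n≤1+n _) 3+M≤
                 , subst (λ w → Adj w (s (2 + M))) sj≡a (step-at c (≤-trans (n≤1+n _) 3+M≤))

    step-bounded : ∀ {s s′} → Step s s′ → Bounded s → Bounded s′
    step-bounded (jump (M≤j , j≤N , _) _)   _             = M≤j , j≤N
    step-bounded (stay {k} {i} ¬reach) (m≤i , i≤N) with m≤n⇒m<n∨m≡n i≤N
    ... | inj₁ i<N  = m≤n⇒m≤1+n m≤i , i<N
    -- At level `N k` a jump is always available, so staying is impossible.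
    ... | inj₂ refl = let j , r = final-reach k in contradiction r (¬reach j)

    run-bounded : ∀ n → Bounded (run n)
    run-bounded zero    = z≤n , z≤n
    run-bounded (suc n) = step-bounded (run-step n) (run-bounded n)

    level-p : ∀ n → level (p n) ≡ idx n
    level-p n = level-at (b (seg n)) (proj₂ (run-bounded n))

    p-start : p 0 ≡ x
    p-start = level≡0⇒origin (level-p 0)

    p-above : ∀ n → 2 ≤ idx n → x ⊏ p n
    p-above n 2≤ = above (b (seg n)) 2≤ (proj₂ (run-bounded n))

    p-adj : ∀ n → Adj (p n) (p (suc n))
    p-adj n = go (run-step n) (run-bounded (suc n))
      where
      go : ∀ {s s′} → Step s s′ → Bounded s′ → Adj (vertex s) (vertex s′)
      go (jump (_ , _ , a) _) _          = a
      go (stay {k} _)         (_ , i<N)  = step-at (b k) i<N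

    idx-adj : ∀ u n → Adj u (p n) → level u ≤ suc (idx n) × idx n ≤ suc (level u)
    idx-adj u n a = subst (λ l → level u ≤ suc l) (level-p n) (level-adj a)
                      , subst (_≤ suc (level u)) (level-p n) (level-adj (~-sym a))

    idx-step : ∀ i j → Adj (p i) (p j) → idx j ≤ suc (idx i)
    idx-step i j a = subst (λ l → idx j ≤ suc l) (level-p i) (proj₂ (idx-adj (p i) j a))

    -- Within one segment the index rises by one per step. The equation is additive to avoid
    -- truncated subtraction.
    later : ∀ {n n′} → n ≤ n′ →
      (seg n′ ≡ seg n × idx n′ + n ≡ idx n + n′) ⊎ seg n < seg n′
    later n≤n′ = go (≤⇒≤′ n≤n′)
      where
      extend : ∀ {n n′ k i s s′} → Step s s′ →
        (proj₁ s ≡ k × proj₂ s + n ≡ i + n′) ⊎ k < proj₁ s →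
        (proj₁ s′ ≡ k × proj₂ s′ + n ≡ i + suc n′) ⊎ k < proj₁ s′
      extend {i = i} (stay _) (inj₁ (refl , eq)) =
        inj₁ (refl , trans (cong suc eq) (sym (+-suc i _)))
      extend (stay _)   (inj₂ k<)         = inj₂ k<
      extend (jump _ _) (inj₁ (refl , _)) = inj₂ ≤-refl
      extend (jump _ _) (inj₂ k<)         = inj₂ (m≤n⇒m≤1+n k<)

      go : ∀ {n n′} → n ≤′ n′ → (seg n′ ≡ seg n × idx n′ + n ≡ idx n + n′) ⊎ seg n < seg n′
      go ≤′-refl             = inj₁ (refl , refl)
      go (≤′-step {n′} n≤n′) = extend (run-step n′) (go n≤n′)

    seg-mono : ∀ {n n′} → n ≤ n′ → seg n ≤ seg n′
    seg-mono n≤n′ with later n≤n′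
    ... | inj₁ (eq , _) = ≤-reflexive (sym eq)
    ... | inj₂ lt       = <⇒≤ lt

    gap : ∀ {a b i j} c → a + i ≡ b + j → c + i ≤ j → c + b ≤ a
    gap {a} {b} {i} {j} c eq c+i≤j = +-cancelʳ-≤ i (c + b) a (begin
      c + b + i    ≡⟨ cong (_+ i) (+-comm c b) ⟩
      b + c + i    ≡⟨ +-assoc b c i ⟩
      b + (c + i)  ≤⟨ +-monoʳ-≤ b c+i≤j ⟩
      b + j        ≡⟨ eq ⟨
      a + i        ∎)
      where open ≤-Reasoning

    -- The cases count the splices between the two vertices. With none, their levels differ by at
    -- least two; with two or more, a whole range of levels separates them; with exactly one, the
    -- jumping rule decides.
    p-nonadj : ∀ {i j} → 2 + i ≤ j → ¬ Adj (p i) (p j)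
    p-nonadj {i} {j} 2+i≤j a with later (≤-trans (m≤n+m i 2) 2+i≤j)
    ... | inj₁ (_ , eq) = contradiction (idx-step i j a) (<⇒≱ (gap 2 eq 2+i≤j))
    ... | inj₂ lt with m≤n⇒m<n∨m≡n lt
    ...   | inj₁ lt′ = contradiction (idx-step i j a) (<⇒≱ (begin
      2 + idx i                    ≤⟨ +-monoʳ-≤ 2 (proj₂ (run-bounded i)) ⟩
      3 + m (suc (seg i))          ≤⟨ m≤n+m _ 9 ⟩
      12 + m (suc (seg i))         ≤⟨ m-gap (suc (seg i)) ⟩
      m (2 + seg i)                ≤⟨ m-mono lt′ ⟩
      m (seg j)                    ≤⟨ proj₁ (run-bounded j) ⟩
      idx j                        ∎))
      where open ≤-Reasoning
    ...   | inj₂ eq = separated (run-step i) (run-bounded j) eq beyond a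
      where
      -- If the run stayed at `p i`, there was no admissible neighbour on the next geodesic. If it
      -- jumped, it took the highest one, and `p j` is strictly higher by `beyond`.
      separated : ∀ {s s′ r} → Step s s′ → Bounded r → suc (proj₁ s) ≡ proj₁ r →
        (proj₁ s′ ≡ proj₁ r → proj₂ s′ < proj₂ r) → ¬ Adj (vertex s) (vertex r)
      separated (stay ¬reach) (M≤j , j≤N) refl _  a = ¬reach _ (M≤j , j≤N , a)
      separated (jump _ max)  (M≤j , j≤N) refl lt a =
        contradiction (max _ (M≤j , j≤N , a)) (<⇒≱ (lt refl))

      beyond : seg (suc i) ≡ seg j → idx (suc i) < idx j
      beyond same with later (≤-trans (n≤1+n (suc i)) 2+i≤j)
      ... | inj₁ (_ , eq) = gap 1 eq 2+i≤j
      ... | inj₂ lt       = contradiction same (<⇒≢ lt)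

    p-induced : IsInfiniteInducedPath G p
    p-induced = infiniteInducedPath G p-adj p-nonadj

    -- Staying on the current geodesic for `suc (N (seg n))` more steps would carry the index past
    -- its bound.
    seg-unbounded : ∀ k → ∃[ n ] k ≤ seg n
    seg-unbounded zero    = 0 , z≤n
    seg-unbounded (suc k) with seg-unbounded k
    ... | n , k≤ with later (m≤m+n n (suc (N (seg n))))
    ...   | inj₂ lt          = n + suc (N (seg n)) , ≤-trans (s≤s k≤) lt
    ...   | inj₁ (same , eq) = contradiction
      (≤-trans (m≤m+n (suc (N (seg n))) (idx n))
        (gap (suc (N (seg n))) eq (≤-reflexive (+-comm (suc (N (seg n))) n))))
      (≤⇒≯ (subst (λ k → idx (n + suc (N (seg n))) ≤ N k) same
        (proj₂ (run-bounded (n + suc (N (seg n)))))))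

    idx-unbounded : ∀ l → ∃[ n ] l ≤ idx n
    idx-unbounded l = let n , l≤ = seg-unbounded l in
      n , ≤-trans (k≤m l) (≤-trans (m-mono l≤) (proj₁ (run-bounded n)))

    p-infinite : ∀ {ℓ} {X : Pred (Vertex G) ℓ} → (∀ n → X (p n)) → HasInfiniteDiameter G X
    p-infinite {X = X} X∋p = unbounded⇒infinite (subst X p-start (X∋p 0))
      (λ l → let n , l≤ = idx-unbounded l in p n , X∋p n , subst (l ≤_) (sym (level-p n)) l≤)

    -- Vertices off the path that touch it.

    idx≤n : ∀ n → idx n ≤ n
    idx≤n zero    = z≤n
    idx≤n (suc n) = ≤-trans (idx-step n (suc n) (p-adj n)) (s≤s (idx≤n n))

    -- A path vertex has only its predecessor and successor on the path, so three neighbours there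
    -- would put two in the same place.
    third-neighbour : ∀ j → Degree≥ G 3 (p j) → ∃[ z ] Adj (p j) z × (∀ i → z ≢ p i)
    third-neighbour j (f , f-injective , f-adj) with em-v {∃[ a ] (∀ i → f a ≢ p i)}
    ... | yes (a , fa∉p) = f a , f-adj a , fa∉p
    ... | no all∈p       = ⊥-elim crowded
      where
      on-path : ∀ a → ∃[ i ] f a ≡ p i
      on-path a with em-v {∃[ i ] f a ≡ p i}
      ... | yes found = found
      ... | no ¬found = contradiction (a , λ i eq → ¬found (i , eq)) all∈p

      place : ∀ a → ∃[ i ] f a ≡ p i × (i ≡ suc j ⊎ j ≡ suc i)
      place a = let i , eq = on-path a in
        i , eq , Attachments.p-consecutive em G p p-induced (subst (Adj (p j)) eq (f-adj a))

      same : ∀ {a b i i′} → f a ≡ p i → f b ≡ p i′ → i ≡ i′ → a ≡ b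
      same eq eq′ refl = f-injective (trans eq (sym eq′))

      both-after : ∀ {a b i i′} → f a ≡ p i → f b ≡ p i′ → i ≡ suc j → i′ ≡ suc j → a ≡ b
      both-after eq eq′ i≡ i′≡ = same eq eq′ (trans i≡ (sym i′≡))

      both-before : ∀ {a b i i′} → f a ≡ p i → f b ≡ p i′ → j ≡ suc i → j ≡ suc i′ → a ≡ b
      both-before eq eq′ j≡ j≡′ = same eq eq′ (suc-injective (trans (sym j≡) j≡′))

      crowded : ⊥
      crowded with place zero | place (suc zero) | place (suc (suc zero))
      ... | _ , e , inj₁ r | _ , e′ , inj₁ r′ | _ = case both-after e e′ r r′ of λ ()
      ... | _ , e , inj₁ r | _ | _ , e″ , inj₁ r″ = case both-after e e″ r r″ of λ ()
      ... | _ | _ , e′ , inj₁ r′ | _ , e″ , inj₁ r″ = case both-after e′ e″ r′ r″ of λ ()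
      ... | _ , e , inj₂ l | _ , e′ , inj₂ l′ | _ = case both-before e e′ l l′ of λ ()
      ... | _ , e , inj₂ l | _ | _ , e″ , inj₂ l″ = case both-before e e″ l l″ of λ ()
      ... | _ | _ , e′ , inj₂ l′ | _ , e″ , inj₂ l″ = case both-before e′ e″ l′ l″ of λ ()

    -- The path starts below `a` and reaches two levels beyond it, hence gets above `a` and must
    -- cross it.
    p-meets : ∀ {a} → x ⊏ a → ∃[ j ] (p j ≡ a ⊎ Adj (p j) a)
    p-meets {a} x⊏a =
      let n , far = idx-unbounded (2 + level a)
          a⊏pn = below (p-above n (≤-trans (m≤m+n 2 (level a)) far))
                       (subst (2 + level a ≤_) (sym (level-p n)) far)
          j , _ , meets = crossing p n (λ {i} _ → p-adj i) (subst (_⊏ a) (sym p-start) x⊏a) a⊏pn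
      in j , meets

    -- The level ranges of different segments overlap only next to the splices.
    seg-unique : ∀ j k → suc (m k) < idx j → idx j < m (suc k) → seg j ≡ k
    seg-unique j k lower upper with <-cmp (seg j) k
    ... | tri≈ _ eq _  = eq
    ... | tri< lt _ _  = contradiction lower
      (≤⇒≯ (≤-trans (proj₂ (run-bounded j)) (s≤s (m-mono lt))))
    ... | tri> _ _ gt  = contradiction upper
      (≤⇒≯ (≤-trans (m-mono gt) (proj₁ (run-bounded j))))

    record Tooth (k : ℕ) : Set (v ⊔ e) where
      field
        tip     : Vertex G
        off     : ∀ j → tip ≢ p j
        root    : ℕ
        touches : Adj tip (p root)
        tip≤y   : level tip ≤ suc (level (y k))
        y≤tip   : level (y k) ≤ suc (level tip)

    -- If `y k` is on the path, a third neighbour of it serves as tip; otherwise `y k` itself does,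
    -- since the path meets everything above `x`.
    tooth : ∀ k → Degree≥ G 3 (y k) → Tooth k
    tooth k degree≥3 with em-v {∃[ j ] y k ≡ p j}
    ... | yes (j , eq) =
      let z , pj~z , z∉p = third-neighbour j (subst (Degree≥ G 3) eq degree≥3)
          y~z = subst (λ u → Adj u z) (sym eq) pj~z
      in record { tip = z ; off = z∉p ; root = j ; touches = ~-sym pj~z
                ; tip≤y = level-adj (~-sym y~z) ; y≤tip = level-adj y~z }
    ... | no y∉p with p-meets (x⊏y k)
    ...   | j , inj₁ pj≡y = contradiction (j , sym pj≡y) y∉p
    ...   | j , inj₂ pj~y = record { tip = y k ; off = λ i eq → y∉p (i , eq) ; root = j
                                   ; touches = ~-sym pj~y ; tip≤y = n≤1+n _ ; y≤tip = n≤1+n _ }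

    module _ (degree≥3 : ∀ k → Degree≥ G 3 (y k)) where
      open Attachments em G p p-induced using (Teeth)

      private
        module T k = Tooth (tooth k (degree≥3 k))

        q : ℕ → Vertex G
        q = T.tip

        first : ∀ k → ∃[ t ] Adj (q k) (p t) × (∀ j → Adj (q k) (p j) → t ≤ j)
        first k = Classical.least em-e (λ j → Adj (q k) (p j)) (T.root k) (T.touches k)

        t : ℕ → ℕ
        t k = proj₁ (first k)

        touch : ∀ k → Adj (q k) (p (t k))
        touch k = proj₁ (proj₂ (first k))

        -- At most two edges lead from `y k` through the tip to the path. The margin of six levels
        -- absorbs them, here and in `idx-high`, so every contact falls where `seg-unique` applies.
        idx-low : ∀ k j → Adj (q k) (p j) → 4 + m k ≤ idx j
        idx-low k j a = s≤s⁻¹ (s≤s⁻¹ (begin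
          6 + m k                  ≤⟨ 6+m≤y k ⟩
          level (y k)              ≤⟨ T.y≤tip k ⟩
          suc (level (q k))        ≤⟨ s≤s (proj₁ (idx-adj (q k) j a)) ⟩
          2 + idx j                ∎))
          where open ≤-Reasoning

        idx-high : ∀ k j → Adj (q k) (p j) → idx j < m (suc k)
        idx-high k j a = begin
          suc (idx j)              ≤⟨ s≤s (proj₂ (idx-adj (q k) j a)) ⟩
          2 + level (q k)          ≤⟨ s≤s (s≤s (T.tip≤y k)) ⟩
          3 + level (y k)          ≤⟨ m≤n+m _ 3 ⟩
          m (suc k)                ∎
          where open ≤-Reasoning

        seg-q : ∀ k j → Adj (q k) (p j) → seg j ≡ k
        seg-q k j a = seg-unique j k (≤-trans (m≤n+m (2 + m k) 2) (idx-low k j a)) (idx-high k j a)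

        at-most-two : ∀ {n j} → n ≤ j → j ≤ 2 + n → j ≡ n ⊎ j ≡ n + 1 ⊎ j ≡ n + 2
        at-most-two {n} {j} n≤j j≤2+n with m≤n⇒m<n∨m≡n n≤j
        ... | inj₂ n≡j = inj₁ (sym n≡j)
        ... | inj₁ n<j with m≤n⇒m<n∨m≡n n<j
        ...   | inj₂ 1+n≡j = inj₂ (inj₁ (trans (sym 1+n≡j) (+-comm 1 n)))
        ...   | inj₁ 1+n<j = inj₂ (inj₂ (trans (≤-antisym j≤2+n 1+n<j) (+-comm 2 n)))

        -- All contacts of `q k` lie on segment `k`, where differences of index equal differences of
        -- level. Their levels are within one of that of `q k`, hence within two of each other.
        window : ∀ k j → Adj (q k) (p j) → j ≡ t k ⊎ j ≡ t k + 1 ⊎ j ≡ t k + 2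
        window k j a with later (proj₂ (proj₂ (first k)) j a)
        ... | inj₂ lt       = contradiction (trans (seg-q k (t k) (touch k)) (sym (seg-q k j a))) (<⇒≢ lt)
        ... | inj₁ (_ , eq) = at-most-two (proj₂ (proj₂ (first k)) j a)
          (+-cancelˡ-≤ (idx (t k)) j (2 + t k) (begin
            idx (t k) + j          ≡⟨ eq ⟨
            idx j + t k            ≤⟨ +-monoˡ-≤ (t k) (proj₂ (idx-adj (q k) j a)) ⟩
            suc (level (q k)) + t k
              ≤⟨ +-monoˡ-≤ (t k) (s≤s (proj₁ (idx-adj (q k) (t k) (touch k)))) ⟩
            2 + idx (t k) + t k    ≡⟨ cong (_+ t k) (+-comm 2 (idx (t k))) ⟩
            idx (t k) + 2 + t k    ≡⟨ +-assoc (idx (t k)) 2 (t k) ⟩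
            idx (t k) + (2 + t k)  ∎))
          where open ≤-Reasoning

        apart : ∀ k k′ j j′ → k < k′ → Adj (q k) (p j) → Adj (q k′) (p j′) → j < j′
        apart k k′ j j′ k<k′ a a′ = ≰⇒> λ j′≤j →
          contradiction (subst₂ _≤_ (seg-q k′ j′ a′) (seg-q k j a) (seg-mono j′≤j)) (<⇒≱ k<k′)

        indep< : ∀ k k′ → k < k′ → ¬ Adj (q k) (q k′)
        indep< k k′ k<k′ a = contradiction (begin
          6 + level (y k)          ≤⟨ m-mono k<k′ ⟩
          m k′                     ≤⟨ m≤n+m (m k′) 6 ⟩
          6 + m k′                 ≤⟨ 6+m≤y k′ ⟩
          level (y k′)             ≤⟨ T.y≤tip k′ ⟩
          suc (level (q k′))       ≤⟨ s≤s (level-adj (~-sym a)) ⟩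
          2 + level (q k)          ≤⟨ s≤s (s≤s (T.tip≤y k)) ⟩
          3 + level (y k)          ∎) (<⇒≱ (m<n+m (3 + level (y k)) {3} (s≤s z≤n)))
          where open ≤-Reasoning

        indep : ∀ k k′ → ¬ Adj (q k) (q k′)
        indep k k′ a with <-cmp k k′
        ... | tri< lt _ _   = indep< k k′ lt a
        ... | tri≈ _ refl _ = irrefl a
        ... | tri> _ _ gt   = indep< k′ k gt (~-sym a)

      teeth : Teeth
      teeth = record
        { q      = q
        ; t      = t
        ; q∉p    = T.off
        ; touch  = touch
        ; window = λ {k} {j} → window k j
        ; apart  = λ {k} {k′} {j} {j′} → apart k k′ j j′
        ; indep  = indep
        ; far    = λ k → ≤-trans (m≤m+n 2 (2 + m k)) (≤-trans (idx-low k (t k) (touch k)) (idx≤n (t k)))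
        }

  ray : (∀ n → ∃[ u ] x ⊏ u × n ≤ level u) →
    Σ[ p ∈ (ℕ → Vertex G) ]
      (p zero ≡ x × IsInfiniteInducedPath G p × HasInfiniteDiameter G (Range p))
  ray high = p , p-start , p-induced , p-infinite (λ n → n , refl)
    where open Ray high

  comb-or-kite : (∀ n → ∃[ u ] (x ⊏ u × n ≤ level u) × Degree≥ G 3 u) →
    Σ[ S ∈ Pred (Vertex G) (v ⊔ e) ]
      ((IsComb (induce G S) ⊎ IsKite (induce G S))
       × HasInfiniteDiameter G S
       × Infinite (Degree≥ (induce G S) 3))
  comb-or-kite high =
    -- The vertices `R.y k` are the very ones supplied by `high`, so they have degree at least 3.
    let T , comb⊎kite = A.comb-or-kite (R.teeth λ k → proj₂ (proj₂ (high (6 + R.m k))))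
    in A.Subgraph.S T , comb⊎kite
     , R.p-infinite (λ n → lift (inj₁ (n , refl))) , A.Subgraph.branching T
    where
    high′ : ∀ n → ∃[ u ] x ⊏ u × n ≤ level u
    high′ n = proj₁ (high n) , proj₁ (proj₂ (high n))

    module R = Ray high′
    module A = Attachments em G R.p R.p-induced

-- The two directions of a poset.

module Incomparability {c ℓ} (em : ExcludedMiddle (c ⊔ ℓ)) {V : Set c} {_≼_ : Rel V ℓ}
  (po : IsPartialOrder _≡_ _≼_) (connected : Connected (Inc po)) (x : V) where
  open IsPartialOrder po using (antisym) renaming (trans to ≼-trans)
  open Graph (Inc po) using (Adj)
  open Distance em (Inc po) connected x

  _≺_ _≻_ : Rel V (c ⊔ ℓ)
  u ≺ w = u ≼ w × u ≢ w
  u ≻ w = w ≺ u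

  ≺-trans : Transitive _≺_
  ≺-trans (a≼b , a≢b) (b≼c , _) = ≼-trans a≼b b≼c , λ { refl → a≢b (antisym a≼b b≼c) }

  ≺-irrefl : ∀ {u} → ¬ u ≺ u
  ≺-irrefl (_ , u≢u) = u≢u refl

  ≺-compare : ∀ u w → u ≡ w ⊎ u ≺ w ⊎ w ≺ u ⊎ Adj u w
  ≺-compare u w with lower-em ℓ em {u ≡ w} | lower-em c em {u ≼ w} | lower-em c em {w ≼ u}
  ... | yes u≡w | _       | _       = inj₁ u≡w
  ... | no u≢w  | yes u≼w | _       = inj₂ (inj₁ (u≼w , u≢w))
  ... | no u≢w  | no _    | yes w≼u = inj₂ (inj₂ (inj₁ (w≼u , u≢w ∘ sym)))
  ... | no _    | no u⋠w  | no w⋠u  = inj₂ (inj₂ (inj₂ (u⋠w , w⋠u)))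

  ≻-compare : ∀ u w → u ≡ w ⊎ u ≻ w ⊎ w ≻ u ⊎ Adj u w
  ≻-compare u w with ≺-compare u w
  ... | inj₁ eq               = inj₁ eq
  ... | inj₂ (inj₁ lt)        = inj₂ (inj₂ (inj₁ lt))
  ... | inj₂ (inj₂ (inj₁ gt)) = inj₂ (inj₁ gt)
  ... | inj₂ (inj₂ (inj₂ a))  = inj₂ (inj₂ (inj₂ a))

  ≻-trans : Transitive _≻_
  ≻-trans a≻b b≻c = ≺-trans b≻c a≻b

  ≺⇒≁ : ∀ {u w} → u ≺ w → ¬ Adj u w
  ≺⇒≁ (u≼w , _) (u⋠w , _) = u⋠w u≼w

  ≻⇒≁ : ∀ {u w} → u ≻ w → ¬ Adj u w
  ≻⇒≁ (w≼u , _) (_ , w⋠u) = w⋠u w≼u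

  -- Reversing the order leaves incomparability unchanged, so the same construction runs downwards
  -- in the same graph.
  module Up   = Upward em (Inc po) connected _≺_ ≺-trans ≺-irrefl ≺⇒≁ ≺-compare x
  module Down = Upward em (Inc po) connected _≻_ ≻-trans ≺-irrefl ≻⇒≁ ≻-compare x

  -- Every vertex of level at least 2 is comparable to `x`, so if the part of `X` above `x` has
  -- bounded level, the part below does not.
  two-sided : ∀ {p} {X : Pred V p} → ExcludedMiddle (c ⊔ ℓ ⊔ p) → Unbounded X →
      (∀ n → ∃[ u ] (x ≺ u × n ≤ level u) × X u)
    ⊎ (∀ n → ∃[ u ] (x ≻ u × n ≤ level u) × X u)
  two-sided {X = X} em′ far with em′ {∃[ n ] ¬ (∃[ u ] (x ≺ u × n ≤ level u) × X u)}
  ... | no ¬bounded = inj₁ λ n → case em′ {∃[ u ] (x ≺ u × n ≤ level u) × X u} of λ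
    { (yes found) → found ; (no ¬found) → contradiction (n , ¬found) ¬bounded }
  ... | yes (n₀ , ¬above) = inj₂ down
    where
    down : ∀ n → ∃[ u ] (x ≻ u × n ≤ level u) × X u
    -- In this level, `n₀` rules out lying above `x`, 2 rules out `x` and its neighbours, and `n` is
    -- the height asked for.
    down n with far (n₀ + (2 + n))
    ... | u , Xu , n≤ with ≺-compare x u
    ...   | inj₁ refl = contradiction (subst (n₀ + (2 + n) ≤_) level-origin n≤)
      (<⇒≱ (≤-trans (s≤s z≤n) (m≤n+m (2 + n) n₀)))
    ...   | inj₂ (inj₁ x≺u)        =
      contradiction (u , (x≺u , ≤-trans (m≤m+n n₀ (2 + n)) n≤) , Xu) ¬above
    ...   | inj₂ (inj₂ (inj₁ x≻u)) =
      u , (x≻u , ≤-trans (≤-trans (m≤n+m n 2) (m≤n+m (2 + n) n₀)) n≤) , Xu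
    ...   | inj₂ (inj₂ (inj₂ (x⋠u , u⋠x))) = contradiction
      (subst (λ l → level u ≤ suc l) level-origin (level-adj (u⋠x , x⋠u)))
      (<⇒≱ (≤-trans (≤-trans (s≤s (s≤s z≤n)) (m≤n+m (2 + n) n₀)) n≤))

-- In an empty graph 0 bounds all distances. This supplies a base vertex for the second claim, where
-- none is given.
infinite⇒inhabited : ∀ {v e p} {G : Graph v e} {X : Pred (Vertex G) p} → ExcludedMiddle v →
  HasInfiniteDiameter G X → Vertex G
infinite⇒inhabited {G = G} em (_ , least-bound) with em {Vertex G}
... | yes u = u
... | no ¬u = case least-bound [ 0 ] (λ u → contradiction u ¬u) of λ ()

theorem3 : ∀ {c ℓ} → ExcludedMiddle (c ⊔ ℓ) →
    {V : Set c} {_≼_ : Rel V ℓ} (po : IsPartialOrder _≡_ _≼_) →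
    let G = Inc po in
    Connected G →
    HasInfiniteDiameter G U →
    (∀ (x : V) → Σ[ p ∈ (ℕ → V) ]
    (p zero ≡ x × IsInfiniteInducedPath G p × HasInfiniteDiameter G (Range p)))
    ×
    (HasInfiniteDiameter G (Degree≥ G 3) →
    Σ[ S ∈ Pred V (c ⊔ ℓ) ]
    ((IsComb (induce G S) ⊎ IsKite (induce G S))
    × HasInfiniteDiameter G S
    × Infinite (Degree≥ (induce G S) 3)))
theorem3 {c} {ℓ} em {V} po connected U-infinite = induced-path , subgraph
  where
  G : Graph c ℓ
  G = Inc po

  induced-path : ∀ x → Σ[ p ∈ (ℕ → V) ]
    (p zero ≡ x × IsInfiniteInducedPath G p × HasInfiniteDiameter G (Range p))
  induced-path x with two-sided em (infinite⇒unbounded (lower-em ℓ em) U-infinite)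
    where
    open Distance em G connected x
    open Incomparability em po connected x
  ... | inj₁ high = Up.ray λ n → let u , far , _ = high n in u , far
    where open Incomparability em po connected x
  ... | inj₂ deep = Down.ray λ n → let u , far , _ = deep n in u , far
    where open Incomparability em po connected x

  subgraph : HasInfiniteDiameter G (Degree≥ G 3) →
    Σ[ S ∈ Pred V (c ⊔ ℓ) ]
    ((IsComb (induce G S) ⊎ IsKite (induce G S))
    × HasInfiniteDiameter G S
    × Infinite (Degree≥ (induce G S) 3))
  -- Applied to the vertices of degree at least 3, so that the targets of the geodesics are
  -- themselves such vertices.
  subgraph infinite with two-sided em (infinite⇒unbounded em infinite)
    where
    o : V
    o = infinite⇒inhabited {G = G} (lower-em ℓ em) infinite
    open Distance em G connected o
    open Incomparability em po connected o
  ... | inj₁ high = Incomparability.Up.comb-or-kite em po connected _ high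
  ... | inj₂ deep = Incomparability.Down.comb-or-kite em po connected _ deep
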